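{- There is an algorithm which, given a finite collection $F$ of nonsingular matrices from $\mathbb{Z}^{2\times 2}$ and a matrix $M\in\mathbb{Z}^{2\times 2}$, decides whether $M\in\langle F\rangle$.
   Context: A matrix is nonsingular if its determinant is nonzero. For a finite set $F\subseteq\mathbb{Z}^{2\times 2}$, $\langle F\rangle$ denotes the semigroup generated by $F$ including the identity matrix: $M\in\langle F\rangle$ iff $M=I$ or $M=M_1\cdots M_k$ for some $k\ge 1$ and $M_1,\dots,M_k\in F$. -}

module Defs where

open import Data.Integer using (ℤ; _+_; _*_; _-_; 0ℤ; 1ℤ)
open import Data.List using (List; []; _∷_)
open import Data.List.Relation.Unary.All using (All)
open import Data.List.Membership.Propositional using (_∈_)
open import Data.Product using (∃-syntax; _×_)
open import Relation.Binary.PropositionalEquality using (_≡_)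
open import Relation.Nullary using (¬_)

record Mat2 : Set where
  constructor mat
  field
    a b c d : ℤ

open Mat2 public

_⊗_ : Mat2 → Mat2 → Mat2
mat a₁ b₁ c₁ d₁ ⊗ mat a₂ b₂ c₂ d₂ =
  mat (a₁ * a₂ + b₁ * c₂) (a₁ * b₂ + b₁ * d₂)
      (c₁ * a₂ + d₁ * c₂) (c₁ * b₂ + d₁ * d₂)

I₂ : Mat2
I₂ = mat 1ℤ 0ℤ 0ℤ 1ℤ

det : Mat2 → ℤ
det (mat a b c d) = a * d - b * c

Nonsingular : Mat2 → Set
Nonsingular M = ¬ (det M ≡ 0ℤ)

prod : List Mat2 → Mat2
prod [] = I₂
prod (M ∷ Ms) = M ⊗ prod Ms

_∈⟨_⟩ : Mat2 → List Mat2 → Set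
M ∈⟨ F ⟩ = ∃[ Ms ] (All (_∈ F) Ms × prod Ms ≡ M)

{-# OPTIONS --safe #-}

-- If M = M₁ ⋯ M_k, write each suffix as M_i ⋯ M_k = H_i U_i with U_i ∈ GL₂(ℤ) and H_i
-- lower triangular and reduced.  Since |det H_i| ≤ |det M|, there are only finitely many
-- H_i, and M_i H_{i+1} = H_i V_i with V_i ∈ GL₂(ℤ).  Hence M ∈ ⟨F⟩ amounts to the existence
-- of a path from M to I with label product I in a finite automaton labelled by GL₂(ℤ).
-- GL₂(ℤ) is an amalgam of two finite groups; split all labels into elements of their union.
-- By ping-pong, every word of length ≥ 2 over the union with product I has two neighbours
-- whose product lies in the union again, so it is enough to close the finite set of
-- transitions under composing two of them whenever the label stays in the union.
module Submission where

open import Defs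
open import Data.Empty using (⊥-elim)
open import Data.Integer using (ℤ; +_; -[1+_]; _+_; _*_; _-_; -_; 0ℤ; 1ℤ; -1ℤ; ∣_∣; _≤_; +≤+; -≤-; _≟_; ≢-nonZero)
open import Data.Integer.DivMod using (_/_; _%_; a≡a%n+[a/n]*n; n%d<d)
open import Data.Integer.Divisibility.Signed using (_∣?_; divides)
import Data.Integer.Properties as ℤ
open import Data.Integer.Tactic.RingSolver using (solve-∀)
open import Data.List using (List; []; _∷_; _++_; length; map; upTo; concatMap; cartesianProduct; cartesianProductWith)
import Data.List.Membership.DecPropositional as DecMembership
open import Data.List.Membership.Propositional using (_∈_; find; lose)
open import Data.List.Membership.Propositional.Properties
  using (∈-++⁺ˡ; ∈-++⁺ʳ; ∈-map⁺; ∈-upTo⁺; ∈-concatMap⁺; ∈-cartesianProduct⁺; ∈-cartesianProduct⁻; ∈-cartesianProductWith⁺)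
open import Data.List.Relation.Unary.All as All using (All; []; _∷_; all?)
import Data.List.Relation.Unary.All.Properties as All
open import Data.List.Relation.Unary.Any using (Any; here; there; any?)
open import Data.Nat as ℕ using (ℕ; zero; suc; z≤n; s≤s)
open import Data.Nat.Induction using (Acc; acc; <-wellFounded)
import Data.Nat.Properties as ℕ
open import Data.Product using (∃-syntax; _×_; _,_; proj₁; proj₂)
open import Data.Product.Properties using (≡-dec)
open import Data.Sum as Sum using (_⊎_; inj₁; inj₂)
open import Relation.Binary.Definitions using (DecidableEquality)
open import Relation.Binary.PropositionalEquality
open import Relation.Nullary using (¬_; Dec; yes; no; ¬?; _×-dec_; _⊎-dec_; map′)
open import Relation.Nullary.Decidable using (True; toWitness; from-yes)

-- Algebra of two-by-two integer matrices.

mat-cong : ∀ {a a′ b b′ c c′ d d′} → a ≡ a′ → b ≡ b′ → c ≡ c′ → d ≡ d′ → mat a b c d ≡ mat a′ b′ c′ d′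
mat-cong refl refl refl refl = refl

infix 4 _≟ᴹ_

_≟ᴹ_ : DecidableEquality Mat2
mat a b c d ≟ᴹ mat a′ b′ c′ d′ =
  map′ (λ (p , q , r , s) → mat-cong p q r s) (λ { refl → refl , refl , refl , refl })
       (a ≟ a′ ×-dec b ≟ b′ ×-dec c ≟ c′ ×-dec d ≟ d′)

open DecMembership _≟ᴹ_ using (_∈?_)

⊗-assoc : ∀ X Y Z → (X ⊗ Y) ⊗ Z ≡ X ⊗ (Y ⊗ Z)
⊗-assoc (mat a b c d) (mat e f g h) (mat i j k l) =
  mat-cong (entry a b e f g h i k) (entry a b e f g h j l) (entry c d e f g h i k) (entry c d e f g h j l)
  where
  entry : ∀ a b e f g h i k →
    (a * e + b * g) * i + (a * f + b * h) * k ≡ a * (e * i + f * k) + b * (g * i + h * k)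
  entry = solve-∀

1*i+0*j : ∀ i j → 1ℤ * i + 0ℤ * j ≡ i
1*i+0*j = solve-∀

0*i+1*j : ∀ i j → 0ℤ * i + 1ℤ * j ≡ j
0*i+1*j = solve-∀

⊗-identityˡ : ∀ X → I₂ ⊗ X ≡ X
⊗-identityˡ (mat a b c d) = mat-cong (1*i+0*j a c) (1*i+0*j b d) (0*i+1*j a c) (0*i+1*j b d)

⊗-identityʳ : ∀ X → X ⊗ I₂ ≡ X
⊗-identityʳ (mat a b c d) = mat-cong (left a b) (right a b) (left c d) (right c d)
  where
  left : ∀ x y → x * 1ℤ + y * 0ℤ ≡ x
  left = solve-∀
  right : ∀ x y → x * 0ℤ + y * 1ℤ ≡ y
  right = solve-∀

det-⊗ : ∀ X Y → det (X ⊗ Y) ≡ det X * det Y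
det-⊗ (mat a b c d) (mat e f g h) = identity a b c d e f g h
  where
  identity : ∀ a b c d e f g h →
    (a * e + b * g) * (c * f + d * h) - (a * f + b * h) * (c * e + d * g) ≡ (a * d - b * c) * (e * h - f * g)
  identity = solve-∀

prod-++ : ∀ xs ys → prod (xs ++ ys) ≡ prod xs ⊗ prod ys
prod-++ []       ys = sym (⊗-identityˡ _)
prod-++ (x ∷ xs) ys = trans (cong (x ⊗_) (prod-++ xs ys)) (sym (⊗-assoc x _ _))

∈⟨⟩-⊗ : ∀ {F X Y} → X ∈⟨ F ⟩ → Y ∈⟨ F ⟩ → (X ⊗ Y) ∈⟨ F ⟩
∈⟨⟩-⊗ (xs , pxs , refl) (ys , pys , refl) = xs ++ ys , All.++⁺ pxs pys , prod-++ xs ys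

∈⇒∈⟨⟩ : ∀ {F X} → X ∈ F → X ∈⟨ F ⟩
∈⇒∈⟨⟩ X∈F = _ ∷ [] , X∈F ∷ [] , ⊗-identityʳ _

∣det∣ : Mat2 → ℕ
∣det∣ X = ∣ det X ∣

∣det∣-⊗ : ∀ X Y → ∣det∣ (X ⊗ Y) ≡ ∣det∣ X ℕ.* ∣det∣ Y
∣det∣-⊗ X Y = trans (cong ∣_∣ (det-⊗ X Y)) (ℤ.abs-* (det X) (det Y))

-- The two finite factors of GL₂(ℤ) and their letters.

-- GL₂(ℤ) = D₄ *_{D₂} D₆.  Here core = D₂, core ∪ leftLetters = D₄ (the signed
-- permutation matrices), and core ∪ rightLetters = D₆ (the matrices permuting
-- the lines spanned by e₁, e₂, e₁ + e₂).
core leftLetters rightLetters letters : List Mat2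
core = mat 1ℤ 0ℤ 0ℤ 1ℤ ∷ mat -1ℤ 0ℤ 0ℤ -1ℤ ∷ mat 0ℤ 1ℤ 1ℤ 0ℤ ∷ mat 0ℤ -1ℤ -1ℤ 0ℤ ∷ []
leftLetters = mat 1ℤ 0ℤ 0ℤ -1ℤ ∷ mat -1ℤ 0ℤ 0ℤ 1ℤ ∷ mat 0ℤ -1ℤ 1ℤ 0ℤ ∷ mat 0ℤ 1ℤ -1ℤ 0ℤ ∷ []
rightLetters = mat 1ℤ -1ℤ 0ℤ -1ℤ ∷ mat -1ℤ 1ℤ 0ℤ 1ℤ ∷ mat 1ℤ -1ℤ 1ℤ 0ℤ ∷ mat -1ℤ 1ℤ -1ℤ 0ℤ ∷
               mat 0ℤ -1ℤ 1ℤ -1ℤ ∷ mat 0ℤ 1ℤ -1ℤ 1ℤ ∷ mat 1ℤ 0ℤ 1ℤ -1ℤ ∷ mat -1ℤ 0ℤ -1ℤ 1ℤ ∷ []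
letters = core ++ leftLetters ++ rightLetters

Alternate : Mat2 → Mat2 → Set
Alternate X Y = (X ∈ leftLetters × Y ∈ rightLetters) ⊎ (X ∈ rightLetters × Y ∈ leftLetters)

abstract
  -- Each of the two finite groups is closed under products, so only letters outside `core` on
  -- opposite sides can fail to merge. `abstract` keeps the table of 256 cases from being unfolded.
  mergeable⊎alternate : ∀ {X Y} → X ∈ letters → Y ∈ letters → (X ⊗ Y) ∈ letters ⊎ Alternate X Y
  mergeable⊎alternate X∈ Y∈ = All.lookup (All.lookup table X∈) Y∈
    where
    table : All (λ X → All (λ Y → (X ⊗ Y) ∈ letters ⊎ Alternate X Y) letters) letters
    table = from-yes (all? (λ X → all? (λ Y → X ⊗ Y ∈? letters ⊎-dec
      ((X ∈? leftLetters ×-dec Y ∈? rightLetters) ⊎-dec (X ∈? rightLetters ×-dec Y ∈? leftLetters))) letters) letters)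

left∩right : ∀ {X} → X ∈ leftLetters → ¬ X ∈ rightLetters
left∩right = All.lookup (from-yes (all? (λ X → ¬? (X ∈? rightLetters)) leftLetters))

∣det∣-letter : ∀ {X} → X ∈ letters → ∣det∣ X ≡ 1
∣det∣-letter = All.lookup (from-yes (all? (λ X → ∣det∣ X ℕ.≟ 1) letters))

-- Ping-pong on integer vectors.

act : Mat2 → ℤ × ℤ → ℤ × ℤ
act (mat a b c d) (x , y) = a * x + b * y , c * x + d * y

act-⊗ : ∀ X Y v → act (X ⊗ Y) v ≡ act X (act Y v)
act-⊗ (mat a b c d) (mat e f g h) (x , y) = cong₂ _,_ (entry a b e f g h x y) (entry c d e f g h x y)
  where
  entry : ∀ a b e f g h x y → (a * e + b * g) * x + (a * f + b * h) * y ≡ a * (e * x + f * y) + b * (g * x + h * y)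
  entry = solve-∀

coordProduct : ℤ × ℤ → ℤ
coordProduct (x , y) = x * y

-- This is the quadratic form x y pulled back along `X`; its three coefficients reduce the effect of
-- each letter to a finite check.
coordProduct-act : ∀ X x y → coordProduct (act X (x , y)) ≡
  (a X * c X) * (x * x) + (a X * d X + b X * c X) * (x * y) + (b X * d X) * (y * y)
coordProduct-act (mat a b c d) x y = identity a b c d x y
  where
  identity : ∀ a b c d x y → (a * x + b * y) * (c * x + d * y) ≡
    (a * c) * (x * x) + (a * d + b * c) * (x * y) + (b * d) * (y * y)
  identity = solve-∀

coordProduct-act-≡ : ∀ X x y {p q r} → a X * c X ≡ p → a X * d X + b X * c X ≡ q → b X * d X ≡ r →
  coordProduct (act X (x , y)) ≡ p * (x * x) + q * (x * y) + r * (y * y)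
coordProduct-act-≡ X x y refl refl refl = coordProduct-act X x y

coordProduct-left : ∀ {X} → X ∈ leftLetters → ∀ v → coordProduct (act X v) ≡ - coordProduct v
coordProduct-left {X} X∈ (x , y) =
  let p , q , r = All.lookup table X∈
  in trans (coordProduct-act-≡ X x y p q r) (negated (x * x) (x * y) (y * y))
  where
  table = from-yes (all? (λ X → a X * c X ≟ 0ℤ ×-dec a X * d X + b X * c X ≟ -1ℤ ×-dec b X * d X ≟ 0ℤ) leftLetters)

  negated : ∀ X Y Z → 0ℤ * X + -1ℤ * Y + 0ℤ * Z ≡ - Y
  negated = solve-∀

coordProduct-right : ∀ {X} → X ∈ rightLetters → ∀ v →
  coordProduct (act X v) ≡ proj₁ v * proj₁ v - coordProduct v ⊎ coordProduct (act X v) ≡ proj₂ v * proj₂ v - coordProduct v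
coordProduct-right {X} X∈ (x , y) = split (All.lookup table X∈)
  where
  table = from-yes (all? (λ X → a X * d X + b X * c X ≟ -1ℤ ×-dec
    ((a X * c X ≟ 1ℤ ×-dec b X * d X ≟ 0ℤ) ⊎-dec (a X * c X ≟ 0ℤ ×-dec b X * d X ≟ 1ℤ))) rightLetters)

  first : ∀ X Y Z → 1ℤ * X + -1ℤ * Y + 0ℤ * Z ≡ X - Y
  first = solve-∀

  second : ∀ X Y Z → 0ℤ * X + -1ℤ * Y + 1ℤ * Z ≡ Z - Y
  second = solve-∀

  split : a X * d X + b X * c X ≡ -1ℤ × (a X * c X ≡ 1ℤ × b X * d X ≡ 0ℤ ⊎ a X * c X ≡ 0ℤ × b X * d X ≡ 1ℤ) →
    coordProduct (act X (x , y)) ≡ x * x - x * y ⊎ coordProduct (act X (x , y)) ≡ y * y - x * y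
  split (q , inj₁ (p , r)) = inj₁ (trans (coordProduct-act-≡ X x y p q r) (first (x * x) (x * y) (y * y)))
  split (q , inj₂ (p , r)) = inj₂ (trans (coordProduct-act-≡ X x y p q r) (second (x * x) (x * y) (y * y)))

1≤i*i : ∀ i → i ≢ 0ℤ → 1ℤ ≤ i * i
1≤i*i (+ zero)  i≢0 = ⊥-elim (i≢0 refl)
1≤i*i (+ suc n) _   = +≤+ (s≤s z≤n)
1≤i*i -[1+ n ]  _   = +≤+ (s≤s z≤n)

data Side : Set where
  left right : Side

data Reduced : Side → List Mat2 → Set where
  [left]  : ∀ {X} → X ∈ leftLetters → Reduced left (X ∷ [])
  [right] : ∀ {X} → X ∈ rightLetters → Reduced right (X ∷ [])
  left∷   : ∀ {X w} → X ∈ leftLetters → Reduced right w → Reduced left (X ∷ w)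
  right∷  : ∀ {X w} → X ∈ rightLetters → Reduced left w → Reduced right (X ∷ w)

-- `k` is 0 for words ending in a left letter and 1 for words ending in a right one. The latter
-- start from t = -1, which the left threshold -1 would admit, so it is lowered to -2.
Bound : ℕ → Side → ℤ → Set
Bound k left  t = t ≤ -[1+ k ]
Bound k right t = + 2 ≤ t

Bound-left : ∀ {k X} v → k ℕ.≤ 1 → X ∈ leftLetters → Bound k right (coordProduct v) → Bound k left (coordProduct (act X v))
Bound-left v k≤1 X∈ 2≤t rewrite coordProduct-left X∈ v = ℤ.≤-trans (ℤ.neg-mono-≤ 2≤t) (-≤- k≤1)

0≰-[1+_] : ∀ k → ¬ (0ℤ ≤ -[1+ k ])
0≰-[1+ k ] ()

-- If x y is negative, both coordinates are nonzero; whichever square appears is at least 1, and - t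
-- adds at least 1 more.
Bound-right : ∀ {k X} v → X ∈ rightLetters → Bound k left (coordProduct v) → Bound k right (coordProduct (act X v))
Bound-right {k} v@(x , y) X∈ t≤ with 1≤-t ← ℤ.≤-trans (+≤+ (s≤s z≤n)) (ℤ.neg-mono-≤ t≤) | coordProduct-right X∈ v
... | inj₁ eq = subst (+ 2 ≤_) (sym eq)
  (ℤ.+-mono-≤ (1≤i*i x λ { refl → 0≰-[1+ k ] (subst (_≤ -[1+ k ]) (ℤ.*-zeroˡ y) t≤) }) 1≤-t)
... | inj₂ eq = subst (+ 2 ≤_) (sym eq)
  (ℤ.+-mono-≤ (1≤i*i y λ { refl → 0≰-[1+ k ] (subst (_≤ -[1+ k ]) (ℤ.*-zeroʳ x) t≤) }) 1≤-t)

-- Ping-pong on the sign of t = x y: left letters map t to - t, right letters to x² - t or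
-- y² - t.  The start vector depends on the last letter and is chosen to violate both bounds.
ping-pong : ∀ {s w} → Reduced s w →
  ∃[ v ] ∃[ k ] k ℕ.≤ 1 × (∀ s → ¬ Bound k s (coordProduct v)) × Bound k s (coordProduct (act (prod w) v))
ping-pong ([left] {X} X∈) = v , 0 , z≤n , (λ { left () ; right (+≤+ (s≤s ())) }) ,
  subst (λ Y → coordProduct (act Y v) ≤ -1ℤ) (sym (⊗-identityʳ X)) (ℤ.≤-reflexive (coordProduct-left X∈ v))
  where v = 1ℤ , 1ℤ
ping-pong ([right] {X} X∈) = v , 1 , s≤s z≤n , (λ { left (-≤- ()) ; right () }) ,
  -- The start value -1 does meet the left bound for `k = 0`, so one right letter lifts it to at
  -- least 2.
  subst (λ Y → + 2 ≤ coordProduct (act Y v)) (sym (⊗-identityʳ X)) (Bound-right {0} v X∈ ℤ.≤-refl)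
  where v = 1ℤ , -1ℤ
ping-pong (left∷ {X} {w} X∈ r) with v , k , k≤1 , ¬bound , bound ← ping-pong r =
  v , k , k≤1 , ¬bound , subst (λ u → Bound k left (coordProduct u)) (sym (act-⊗ X (prod w) v)) (Bound-left _ k≤1 X∈ bound)
ping-pong (right∷ {X} {w} X∈ r) with v , k , k≤1 , ¬bound , bound ← ping-pong r =
  v , k , k≤1 , ¬bound , subst (λ u → Bound k right (coordProduct u)) (sym (act-⊗ X (prod w) v)) (Bound-right _ X∈ bound)

act-I₂ : ∀ v → act I₂ v ≡ v
act-I₂ (x , y) = cong₂ _,_ (1*i+0*j x y) (0*i+1*j x y)

reduced≢I₂ : ∀ {s w} → Reduced s w → prod w ≢ I₂
reduced≢I₂ {s} r w≡I with v , k , _ , ¬bound , bound ← ping-pong r =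
  ¬bound s (subst (λ u → Bound k s (coordProduct u)) (trans (cong (λ X → act X v) w≡I) (act-I₂ v)) bound)

-- Hermite forms and generation of GL₂(ℤ) by the letters.

letter : ∀ X → {_ : True (X ∈? letters)} → X ∈⟨ letters ⟩
letter X {p} = ∈⇒∈⟨⟩ (toWitness p)

-- A right and a left reflection multiply to the matrix with q = 1; both are involutions, so the
-- reversed product gives q = -1.
unipotent : ∀ q → mat 1ℤ q 0ℤ 1ℤ ∈⟨ letters ⟩
unipotent (+ zero) = letter I₂
unipotent (+ suc n) = subst (_∈⟨ letters ⟩) (mat-cong refl (entry (+ n)) refl refl)
  (∈⟨⟩-⊗ (∈⟨⟩-⊗ (letter (mat 1ℤ -1ℤ 0ℤ -1ℤ)) (letter (mat 1ℤ 0ℤ 0ℤ -1ℤ))) (unipotent (+ n)))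
  where
  entry : ∀ q → 1ℤ * q + 1ℤ * 1ℤ ≡ 1ℤ + q
  entry = solve-∀
unipotent -[1+ n ] = subst (_∈⟨ letters ⟩) (mat-cong refl (trans (entry (- + n)) (sym (ℤ.neg-suc n))) refl refl)
  (∈⟨⟩-⊗ (∈⟨⟩-⊗ (letter (mat 1ℤ 0ℤ 0ℤ -1ℤ)) (letter (mat 1ℤ -1ℤ 0ℤ -1ℤ))) (negative n))
  where
  entry : ∀ q → 1ℤ * q + -1ℤ * 1ℤ ≡ -1ℤ + q
  entry = solve-∀
  negative : ∀ n → mat 1ℤ (- + n) 0ℤ 1ℤ ∈⟨ letters ⟩
  negative zero    = unipotent (+ zero)
  negative (suc n) = unipotent -[1+ n ]

euclid-step : ∀ q → mat q 1ℤ 1ℤ 0ℤ ∈⟨ letters ⟩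
euclid-step q = subst (_∈⟨ letters ⟩) (mat-cong (entry₁ q) (entry₂ q) refl refl)
  (∈⟨⟩-⊗ (unipotent q) (letter (mat 0ℤ 1ℤ 1ℤ 0ℤ)))
  where
  entry₁ : ∀ q → 1ℤ * 0ℤ + q * 1ℤ ≡ q
  entry₁ = solve-∀
  entry₂ : ∀ q → 1ℤ * 1ℤ + q * 0ℤ ≡ 1ℤ
  entry₂ = solve-∀

lower-unipotent : ∀ q → mat 1ℤ 0ℤ q 1ℤ ∈⟨ letters ⟩
lower-unipotent q = subst (_∈⟨ letters ⟩) (mat-cong (0*i+1*j q 1ℤ) refl (1*i+0*j q 1ℤ) refl)
  (∈⟨⟩-⊗ (letter (mat 0ℤ 1ℤ 1ℤ 0ℤ)) (euclid-step q))

-- Euclid's algorithm on the first row: if a = q b + r, then (a, b) is (b, r) times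
-- `mat q 1ℤ 1ℤ 0ℤ`, and the remainder takes the place of b until it vanishes.
triangularise : ∀ P → Acc ℕ._<_ ∣ b P ∣ → ∃[ H ] ∃[ V ] V ∈⟨ letters ⟩ × H ⊗ V ≡ P × b H ≡ 0ℤ
triangularise P@(mat a b c d) (acc rec) with b ≟ 0ℤ
... | yes b≡0 = P , I₂ , letter I₂ , ⊗-identityʳ P , b≡0
... | no  b≢0 =
  let H , V , V∈ , HV≡ , bH≡0 = triangularise (mat b (+ r) d (c - d * q)) (rec (n%d<d a b))
  in H , V ⊗ mat q 1ℤ 1ℤ 0ℤ , ∈⟨⟩-⊗ V∈ (euclid-step q) ,
     trans (sym (⊗-assoc H V _)) (trans (cong (_⊗ mat q 1ℤ 1ℤ 0ℤ) HV≡)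
       (mat-cong (trans (entry₁ b q (+ r)) (sym (a≡a%n+[a/n]*n a b))) (entry₂ b (+ r)) (entry₃ c d q) (entry₂ d (c - d * q)))) ,
     bH≡0
  where
  instance b-nonZero = ≢-nonZero b≢0
  q = a / b
  r = a % b
  entry₁ : ∀ b q r → b * q + r * 1ℤ ≡ r + q * b
  entry₁ = solve-∀
  entry₂ : ∀ b r → b * 1ℤ + r * 0ℤ ≡ b
  entry₂ = solve-∀
  entry₃ : ∀ c d q → d * q + (c - d * q) * 1ℤ ≡ c
  entry₃ = solve-∀

-- The lower left entry is reduced modulo the lower right one, which is nonzero by nonsingularity.
-- Diagonal signs stay free: finitely many forms per determinant suffice.
hermite : ∀ P → Nonsingular P → ∃[ H ] ∃[ V ] V ∈⟨ letters ⟩ × H ⊗ V ≡ P × b H ≡ 0ℤ × ∣ c H ∣ ℕ.< ∣ d H ∣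
hermite P detP≢0 with triangularise P (<-wellFounded _)
... | mat p .0ℤ r s , V , V∈ , refl , refl =
  mat p 0ℤ (+ (r % s)) s , mat 1ℤ 0ℤ (r / s) 1ℤ ⊗ V , ∈⟨⟩-⊗ (lower-unipotent (r / s)) V∈ ,
  trans (sym (⊗-assoc (mat p 0ℤ (+ (r % s)) s) (mat 1ℤ 0ℤ (r / s) 1ℤ) V)) (cong (_⊗ V) (mat-cong (entry₁ p (r / s)) (entry₂ p)
    (trans (entry₃ s (r / s) (+ (r % s))) (sym (a≡a%n+[a/n]*n r s))) (entry₄ s (+ (r % s))))) ,
  refl , n%d<d r s
  where
  vanishing : ∀ p r → p * 0ℤ - 0ℤ * r ≡ 0ℤ
  vanishing = solve-∀
  instance s-nonZero = ≢-nonZero λ s≡0 → detP≢0 (trans (det-⊗ (mat p 0ℤ r s) V)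
             (cong (_* det V) (trans (cong (λ s → p * s - 0ℤ * r) s≡0) (vanishing p r))))
  entry₁ : ∀ p q → p * 1ℤ + 0ℤ * q ≡ p
  entry₁ = solve-∀
  entry₂ : ∀ p → p * 0ℤ + 0ℤ * 1ℤ ≡ 0ℤ
  entry₂ = solve-∀
  entry₃ : ∀ s q r → r * 1ℤ + s * q ≡ r + q * s
  entry₃ = solve-∀
  entry₄ : ∀ s r → r * 0ℤ + s * 1ℤ ≡ s
  entry₄ = solve-∀

∣det∣-lower : ∀ H → b H ≡ 0ℤ → ∣det∣ H ≡ ∣ a H ∣ ℕ.* ∣ d H ∣
∣det∣-lower (mat p .0ℤ r s) refl = trans (cong ∣_∣ (entry p r s)) (ℤ.abs-* p s)
  where
  entry : ∀ p r s → p * s - 0ℤ * r ≡ p * s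
  entry = solve-∀

∣det∣-∈⟨letters⟩ : ∀ {V} → V ∈⟨ letters ⟩ → ∣det∣ V ≡ 1
∣det∣-∈⟨letters⟩ (_ , all , refl) = ∣det∣-prod all
  where
  ∣det∣-prod : ∀ {w} → All (_∈ letters) w → ∣det∣ (prod w) ≡ 1
  ∣det∣-prod [] = refl
  ∣det∣-prod {X ∷ w} (X∈ ∷ w∈) = trans (∣det∣-⊗ X (prod w)) (cong₂ ℕ._*_ (∣det∣-letter X∈) (∣det∣-prod w∈))

∣det∣≢0 : ∀ {X} → Nonsingular X → ∣det∣ X ≢ 0
∣det∣≢0 X≢0 eq = X≢0 (ℤ.∣i∣≡0⇒i≡0 eq)

-- Determinant ±1 makes the diagonal of the Hermite form ±1 and its reduced entry 0; the four
-- matrices left are letters.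
unimodular⇒∈⟨letters⟩ : ∀ {V} → ∣det∣ V ≡ 1 → V ∈⟨ letters ⟩
unimodular⇒∈⟨letters⟩ {V} ∣V∣≡1 with hermite V (λ eq → ℕ.0≢1+n (trans (sym (cong ∣_∣ eq)) ∣V∣≡1))
... | H@(mat p .0ℤ r s) , W , W∈ , refl , refl , r<s =
  ∈⟨⟩-⊗ (diagonal p r s (ℕ.m*n≡1⇒m≡1 ∣ p ∣ ∣ s ∣ ps≡1) ∣s∣≡1
    (ℤ.∣i∣≡0⇒i≡0 (ℕ.n<1⇒n≡0 (subst (∣ r ∣ ℕ.<_) ∣s∣≡1 r<s)))) W∈
  where
  ps≡1 : ∣ p ∣ ℕ.* ∣ s ∣ ≡ 1
  ps≡1 = trans (sym (∣det∣-lower H refl)) (ℕ.m*n≡1⇒m≡1 (∣det∣ H) (∣det∣ W) (trans (sym (∣det∣-⊗ H W)) ∣V∣≡1))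
  ∣s∣≡1 : ∣ s ∣ ≡ 1
  ∣s∣≡1 = ℕ.m*n≡1⇒n≡1 ∣ p ∣ ∣ s ∣ ps≡1
  diagonal : ∀ p r s → ∣ p ∣ ≡ 1 → ∣ s ∣ ≡ 1 → r ≡ 0ℤ → mat p 0ℤ r s ∈⟨ letters ⟩
  diagonal (+ 1)    _ (+ 1)    refl refl refl = letter _
  diagonal (+ 1)    _ -[1+ 0 ] refl refl refl = letter _
  diagonal -[1+ 0 ] _ (+ 1)    refl refl refl = letter _
  diagonal -[1+ 0 ] _ -[1+ 0 ] refl refl refl = letter _

-- Inverses and quotients of integer matrices.

-- The inverse is det W · adj W because (det W)² = 1.
rightInverse : ∀ W → ∣det∣ W ≡ 1 → ∃[ W′ ] W ⊗ W′ ≡ I₂ × ∣det∣ W′ ≡ 1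
rightInverse W@(mat a b c d) ∣W∣≡1 = W′ , W⊗W′≡I , ℕ.m*n≡1⇒n≡1 (∣det∣ W) (∣det∣ W′)
    (trans (sym (∣det∣-⊗ W W′)) (cong ∣det∣ W⊗W′≡I))
  where
  W′ = mat (det W * d) (- (det W * b)) (- (det W * c)) (det W * a)
  square : ∀ i → ∣ i ∣ ≡ 1 → i * i ≡ 1ℤ
  square (+ 1)    refl = refl
  square -[1+ 0 ] refl = refl
  entry₁ : ∀ a b c d e → a * (e * d) + b * - (e * c) ≡ e * (a * d - b * c)
  entry₁ = solve-∀
  entry₂ : ∀ a b e → a * - (e * b) + b * (e * a) ≡ 0ℤ
  entry₂ = solve-∀
  entry₃ : ∀ c d e → c * (e * d) + d * - (e * c) ≡ 0ℤ
  entry₃ = solve-∀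
  entry₄ : ∀ a b c d e → c * - (e * b) + d * (e * a) ≡ e * (a * d - b * c)
  entry₄ = solve-∀
  W⊗W′≡I : W ⊗ W′ ≡ I₂
  W⊗W′≡I = mat-cong (trans (entry₁ a b c d (det W)) (square (det W) ∣W∣≡1)) (entry₂ a b (det W))
    (entry₃ c d (det W)) (trans (entry₄ a b c d (det W)) (square (det W) ∣W∣≡1))

-- When k does not divide x the quotient is an arbitrary integer.
quotient : ∀ k x → k ≢ 0ℤ → ∃[ q ] (∀ v → k * v ≡ x → v ≡ q)
quotient k x k≢0 with k ∣? x
... | yes (divides q x≡qk) = q , λ v kv≡x →
        ℤ.*-cancelˡ-≡ k v q {{≢-nonZero k≢0}} (trans kv≡x (trans x≡qk (ℤ.*-comm q k)))
... | no ¬k∣x = 0ℤ , λ v kv≡x → ⊥-elim (¬k∣x (divides v (trans (sym kv≡x) (ℤ.*-comm k v))))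

-- Cramer's rule; the matrix V₀ is meaningful only if H V = P is solvable over ℤ.
leftQuotient : ∀ H P → Nonsingular H → ∃[ V₀ ] (∀ V → H ⊗ V ≡ P → V ≡ V₀)
leftQuotient H@(mat a b c d) (mat p q r s) H≢0 =
  let v , v-unique = quotient (det H) (d * p - b * r) H≢0
      w , w-unique = quotient (det H) (d * q - b * s) H≢0
      x , x-unique = quotient (det H) (a * r - c * p) H≢0
      y , y-unique = quotient (det H) (a * s - c * q) H≢0
  in mat v w x y , λ { (mat e f g h) refl → mat-cong
       (v-unique e (top a b c d e g)) (w-unique f (top a b c d f h))
       (x-unique g (bottom a b c d e g)) (y-unique h (bottom a b c d f h)) }
  where
  top : ∀ a b c d e g → (a * d - b * c) * e ≡ d * (a * e + b * g) - b * (c * e + d * g)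
  top = solve-∀
  bottom : ∀ a b c d e g → (a * d - b * c) * g ≡ a * (c * e + d * g) - c * (a * e + b * g)
  bottom = solve-∀

⊗-cancelˡ : ∀ {H V W} → Nonsingular H → H ⊗ V ≡ H ⊗ W → V ≡ W
⊗-cancelˡ {H} {V} {W} H≢0 eq with V₀ , unique ← leftQuotient H (H ⊗ W) H≢0 = trans (unique V eq) (sym (unique W refl))

-- Closure of a finite set under a binary rule.

extract : ∀ {A : Set} {P : A → Set} {xs} → Any P xs →
  ∃[ x ] ∃[ ys ] P x × x ∈ xs × (∀ {z} → z ∈ ys → z ∈ xs) × (∀ {z} → z ∈ xs → z ≡ x ⊎ z ∈ ys) ×
  length xs ≡ suc (length ys)
extract {xs = x ∷ xs} (here px) =
  x , xs , px , here refl , there , (λ { (here z≡x) → inj₁ z≡x ; (there z∈) → inj₂ z∈ }) , refl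
extract {xs = x ∷ xs} (there p) with y , ys , py , y∈ , ys⊆xs , split , len ← extract p =
  y , x ∷ ys , py , there y∈ , (λ { (here z≡x) → here z≡x ; (there z∈) → there (ys⊆xs z∈) }) , split′ , cong suc len
  where
  split′ : ∀ {z} → z ∈ x ∷ xs → z ≡ y ⊎ z ∈ x ∷ ys
  split′ (here z≡x) = inj₂ (here z≡x)
  split′ (there z∈) = Sum.map₂ there (split z∈)

module Saturation {T : Set} (universe : List T) {Base : T → Set} {Step : T → T → T → Set}
  (base? : ∀ t → Dec (Base t)) (step? : ∀ u v t → Dec (Step u v t)) where

  data Derivable : T → Set where
    base : ∀ {t} → t ∈ universe → Base t → Derivable t
    step : ∀ {u v t} → t ∈ universe → Derivable u → Derivable v → Step u v t → Derivable t

  Immediate : List T → T → Set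
  Immediate known t = Base t ⊎ Any (λ u → Any (λ v → Step u v t) known) known

  immediate? : ∀ known t → Dec (Immediate known t)
  immediate? known t = base? t ⊎-dec any? (λ u → any? (λ v → step? u v t) known) known

  immediate⇒derivable : ∀ {known t} → All Derivable known → t ∈ universe → Immediate known t → Derivable t
  immediate⇒derivable known t∈ (inj₁ b) = base t∈ b
  immediate⇒derivable known t∈ (inj₂ p) with u , u∈ , q ← find p with v , v∈ , s ← find q =
    step t∈ (All.lookup known u∈) (All.lookup known v∈) s

  -- Each round moves one immediate consequence out of `pending`, whose length `n` drives the
  -- recursion. Once none is left, `known` is closed under both rules.
  saturate : ∀ n known pending → length pending ≡ n → All Derivable known →
    (∀ {t} → t ∈ pending → t ∈ universe) → (∀ {t} → t ∈ universe → t ∈ known ⊎ t ∈ pending) →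
    ∃[ closure ] All Derivable closure × (∀ {t} → Derivable t → t ∈ closure)
  saturate n known pending len sound ⊆universe cover with any? (immediate? known) pending
  ... | no ¬new = known , sound , complete
    where
    keep : ∀ {t} → t ∈ universe → Immediate known t → t ∈ known
    keep t∈ imm with cover t∈
    ... | inj₁ t∈known   = t∈known
    ... | inj₂ t∈pending = ⊥-elim (¬new (lose t∈pending imm))
    complete : ∀ {t} → Derivable t → t ∈ known
    complete (base t∈ b)       = keep t∈ (inj₁ b)
    complete (step t∈ du dv s) = keep t∈ (inj₂ (lose (complete du) (lose (complete dv) s)))
  saturate n known pending len sound ⊆universe cover | yes new
    with t , rest , imm , t∈ , rest⊆ , split , len′ ← extract new | n
  ... | zero  with () ← trans (sym len′) len
  ... | suc m = saturate m (t ∷ known) rest (ℕ.suc-injective (trans (sym len′) len))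
                  (immediate⇒derivable sound (⊆universe t∈) imm ∷ sound) (λ s∈ → ⊆universe (rest⊆ s∈)) cover′
    where
    cover′ : ∀ {s} → s ∈ universe → s ∈ t ∷ known ⊎ s ∈ rest
    cover′ s∈ with cover s∈
    ... | inj₁ s∈known = inj₁ (there s∈known)
    ... | inj₂ s∈pending = Sum.map₁ here (split s∈pending)

  derivable? : (∀ (s t : T) → Dec (s ≡ t)) → ∀ t → Dec (Derivable t)
  derivable? _≟_ t with closure , sound , complete ← saturate _ [] universe refl [] (λ t∈ → t∈) inj₂ =
    map′ (All.lookup sound) complete (any? (t ≟_) closure)

-- The automaton and the collapsing of its paths.

module Automaton (F S : List Mat2) where

  -- (A , X , B) records that A X = N B for some N ∈ ⟨ F ⟩.
  Transition : Set
  Transition = Mat2 × Mat2 × Mat2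

  -- `I₂` stands beside `F` so that a transition can also read a letter without consuming a
  -- generator.
  Base : Transition → Set
  Base (A , X , B) = Any (λ N → A ⊗ X ≡ N ⊗ B) (I₂ ∷ F)

  Step : Transition → Transition → Transition → Set
  Step (A , X , B) (B′ , Y , C) t = B ≡ B′ × t ≡ (A , X ⊗ Y , C)

  infix 4 _≟ᵀ_

  _≟ᵀ_ : (s t : Transition) → Dec (s ≡ t)
  _≟ᵀ_ = ≡-dec _≟ᴹ_ (≡-dec _≟ᴹ_ _≟ᴹ_)

  transitions : List Transition
  transitions = cartesianProduct S (cartesianProduct letters S)

  open Saturation transitions {Base} {Step} (λ (A , X , B) → any? (λ N → A ⊗ X ≟ᴹ N ⊗ B) (I₂ ∷ F))
    (λ (A , X , B) (B′ , Y , C) t → B ≟ᴹ B′ ×-dec t ≟ᵀ (A , X ⊗ Y , C)) public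

  ∈-transitions⁺ : ∀ {A X B} → A ∈ S → X ∈ letters → B ∈ S → (A , X , B) ∈ transitions
  ∈-transitions⁺ A∈ X∈ B∈ = ∈-cartesianProduct⁺ A∈ (∈-cartesianProduct⁺ X∈ B∈)

  derivable⇒∈ : ∀ {t} → Derivable t → t ∈ transitions
  derivable⇒∈ (base t∈ _)     = t∈
  derivable⇒∈ (step t∈ _ _ _) = t∈

  ∈-transitions⁻ : ∀ {A X B} → Derivable (A , X , B) → A ∈ S × X ∈ letters × B ∈ S
  ∈-transitions⁻ δ with A∈ , XB∈ ← ∈-cartesianProduct⁻ S _ (derivable⇒∈ δ) = A∈ , ∈-cartesianProduct⁻ letters S XB∈

  derivable-sound : ∀ {A X B} → Derivable (A , X , B) → ∃[ N ] N ∈⟨ F ⟩ × A ⊗ X ≡ N ⊗ B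
  derivable-sound (base _ (here eq)) = I₂ , ([] , [] , refl) , eq
  derivable-sound (base _ (there p)) with N , N∈ , eq ← find p = N , ∈⇒∈⟨⟩ N∈ , eq
  derivable-sound (step {A , X , B} {_ , Y , C} _ δ ε (refl , refl))
    with N , N∈ , AX≡NB ← derivable-sound δ | N′ , N′∈ , BY≡N′C ← derivable-sound ε =
    N ⊗ N′ , ∈⟨⟩-⊗ N∈ N′∈ , (begin
      A ⊗ (X ⊗ Y)    ≡⟨ ⊗-assoc A X Y ⟨
      (A ⊗ X) ⊗ Y    ≡⟨ cong (_⊗ Y) AX≡NB ⟩
      (N ⊗ B) ⊗ Y    ≡⟨ ⊗-assoc N B Y ⟩
      N ⊗ (B ⊗ Y)    ≡⟨ cong (N ⊗_) BY≡N′C ⟩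
      N ⊗ (N′ ⊗ C)   ≡⟨ ⊗-assoc N N′ C ⟨
      (N ⊗ N′) ⊗ C   ∎)
    where open ≡-Reasoning

  data Path (A : Mat2) : List Mat2 → Mat2 → Set where
    []  : Path A [] A
    _∷_ : ∀ {X B w C} → Derivable (A , X , B) → Path B w C → Path A (X ∷ w) C

  infixr 5 _++ᴾ_

  _++ᴾ_ : ∀ {A u B v C} → Path A u B → Path B v C → Path A (u ++ v) C
  []      ++ᴾ q = q
  (δ ∷ p) ++ᴾ q = δ ∷ (p ++ᴾ q)

  path-letters : ∀ {A w B} → Path A w B → All (_∈ letters) w
  path-letters []      = []
  path-letters (δ ∷ p) = proj₁ (proj₂ (∈-transitions⁻ δ)) ∷ path-letters p

  merge : ∀ {A X B Y C} → Derivable (A , X , B) → Derivable (B , Y , C) → X ⊗ Y ∈ letters → Derivable (A , X ⊗ Y , C)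
  merge δ ε XY∈ = step (∈-transitions⁺ (proj₁ (∈-transitions⁻ δ)) XY∈ (proj₂ (proj₂ (∈-transitions⁻ ε)))) δ ε (refl , refl)

  -- One-letter words are kept apart because a letter of `core` neither shortens nor counts as
  -- reduced.
  data Shape (A X : Mat2) : List Mat2 → Mat2 → Set where
    single  : ∀ {B} → Derivable (A , X , B) → Shape A X [] B
    shorter : ∀ {Y w B v} → Path A v B → prod v ≡ prod (X ∷ Y ∷ w) → length v ≡ suc (length w) → Shape A X (Y ∷ w) B
    reduced : ∀ {w B s} → Reduced s (X ∷ w) → Shape A X w B

  -- If the first two labels do not merge, they alternate, and the first extends a reduced tail;
  -- disjointness of the two sides rules out a tail of the wrong side.
  shape : ∀ {A X w B} → Path A (X ∷ w) B → Shape A X w B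
  shape (δ ∷ []) = single δ
  shape {X = X} (δ ∷ (_∷_ {X = Y} {w = w} ε p))
    with mergeable⊎alternate (proj₁ (proj₂ (∈-transitions⁻ δ))) (proj₁ (proj₂ (∈-transitions⁻ ε)))
  ... | inj₁ XY∈ = shorter (merge δ ε XY∈ ∷ p) (⊗-assoc X Y (prod w)) refl
  ... | inj₂ alternate with shape (ε ∷ p) | alternate
  ...   | shorter q eq len           | _                = shorter (δ ∷ q) (cong (X ⊗_) eq) (cong suc len)
  ...   | single _                   | inj₁ (X∈ , Y∈)   = reduced (left∷ X∈ ([right] Y∈))
  ...   | single _                   | inj₂ (X∈ , Y∈)   = reduced (right∷ X∈ ([left] Y∈))
  ...   | reduced r@([right] _)      | inj₁ (X∈ , _)    = reduced (left∷ X∈ r)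
  ...   | reduced r@(right∷ _ _)     | inj₁ (X∈ , _)    = reduced (left∷ X∈ r)
  ...   | reduced r@([left] _)       | inj₂ (X∈ , _)    = reduced (right∷ X∈ r)
  ...   | reduced r@(left∷ _ _)      | inj₂ (X∈ , _)    = reduced (right∷ X∈ r)
  ...   | reduced ([left] Y∈left)    | inj₁ (_ , Y∈)    = ⊥-elim (left∩right Y∈left Y∈)
  ...   | reduced (left∷ Y∈left _)   | inj₁ (_ , Y∈)    = ⊥-elim (left∩right Y∈left Y∈)
  ...   | reduced ([right] Y∈right)  | inj₂ (_ , Y∈)    = ⊥-elim (left∩right Y∈ Y∈right)
  ...   | reduced (right∷ Y∈right _) | inj₂ (_ , Y∈)    = ⊥-elim (left∩right Y∈ Y∈right)

  -- Ping-pong excludes reduced words, so the path shortens with its product unchanged until a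
  -- single transition carries that product.
  collapse : ∀ n {A w B} → length w ≡ suc n → Path A w B → prod w ≡ I₂ → Derivable (A , I₂ , B)
  collapse n {w = X ∷ _} len p w≡I with shape p
  collapse n       len p w≡I | single δ          = subst (λ Y → Derivable (_ , Y , _)) (trans (sym (⊗-identityʳ _)) w≡I) δ
  collapse n       len p w≡I | reduced r         = ⊥-elim (reduced≢I₂ r w≡I)
  collapse (suc n) len p w≡I | shorter q eq len′ =
    collapse n (trans len′ (ℕ.suc-injective len)) q (trans eq w≡I)

-- Precomputed words between matrices and a box of Hermite forms.

trail : Mat2 → List Mat2 → List Mat2
trail A []      = A ∷ []
trail A (X ∷ w) = A ∷ trail (A ⊗ X) w

start∈trail : ∀ A w → A ∈ trail A w
start∈trail A []      = here refl
start∈trail A (X ∷ w) = here refl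

end∈trail : ∀ A w → A ⊗ prod w ∈ trail A w
end∈trail A []      = here (⊗-identityʳ A)
end∈trail A (X ∷ w) = there (subst (_∈ trail (A ⊗ X) w) (⊗-assoc A X (prod w)) (end∈trail (A ⊗ X) w))

-- Cramer's rule determines `V` from `A` and `B`, so the word is found before any `V` is given and
-- its trail can supply states. The empty word is a default when no such `V` is available.
connect : ∀ A B → ∃[ w ] All (_∈ letters) w ×
  (Nonsingular A → ∀ V → ∣det∣ V ≡ 1 → A ⊗ V ≡ B → prod w ≡ V)
connect A B with det A ≟ 0ℤ
... | yes A≡0 = [] , [] , λ A≢0 → ⊥-elim (A≢0 A≡0)
... | no  A≢0 with V₀ , unique ← leftQuotient A B A≢0 with ∣det∣ V₀ ℕ.≟ 1
...   | no  ¬unit = [] , [] , λ _ V unit eq → ⊥-elim (¬unit (subst (λ V → ∣det∣ V ≡ 1) (unique V eq) unit))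
...   | yes unit with w , w∈ , eq₀ ← unimodular⇒∈⟨letters⟩ unit = w , w∈ , λ _ V _ eq → trans eq₀ (sym (unique V eq))

interval : ℕ → List ℤ
interval n = map +_ (upTo (suc n)) ++ map -[1+_] (upTo n)

∈-interval : ∀ {n} i → ∣ i ∣ ℕ.≤ n → i ∈ interval n
∈-interval (+ m)    m≤n = ∈-++⁺ˡ (∈-map⁺ +_ (∈-upTo⁺ (s≤s m≤n)))
∈-interval -[1+ m ] m<n = ∈-++⁺ʳ (map +_ (upTo _)) (∈-map⁺ -[1+_] (∈-upTo⁺ m<n))

fromRows : ℤ × ℤ → ℤ × ℤ → Mat2
fromRows (a , b) (c , d) = mat a b c d

box : ℕ → List Mat2
box n = cartesianProductWith fromRows pairs pairs
  where pairs = cartesianProduct (interval n) (interval n)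

lower∈box : ∀ {n} H → Nonsingular H → b H ≡ 0ℤ → ∣ c H ∣ ℕ.< ∣ d H ∣ → ∣det∣ H ℕ.≤ n → H ∈ box n
lower∈box {n} H@(mat p .0ℤ r s) H≢0 refl r<s H≤n =
  ∈-cartesianProductWith⁺ fromRows (∈-cartesianProduct⁺ (∈-interval {n} p p≤n) (∈-interval {n} 0ℤ z≤n))
    (∈-cartesianProduct⁺ (∈-interval {n} r (ℕ.≤-trans (ℕ.<⇒≤ r<s) s≤n)) (∈-interval {n} s s≤n))
  where
  ps≤n : ∣ p ∣ ℕ.* ∣ s ∣ ℕ.≤ n
  ps≤n = subst (ℕ._≤ n) (∣det∣-lower H refl) H≤n
  ps≢0 : ℕ.NonZero (∣ p ∣ ℕ.* ∣ s ∣)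
  ps≢0 = ℕ.≢-nonZero (subst (_≢ 0) (∣det∣-lower H refl) (∣det∣≢0 {H} H≢0))
  p≤n : ∣ p ∣ ℕ.≤ n
  p≤n = ℕ.≤-trans (ℕ.m≤m*n ∣ p ∣ ∣ s ∣ {{ℕ.m*n≢0⇒n≢0 ∣ p ∣ {{ps≢0}}}}) ps≤n
  s≤n : ∣ s ∣ ℕ.≤ n
  s≤n = ℕ.≤-trans (ℕ.m≤n*m ∣ s ∣ ∣ p ∣ {{ℕ.m*n≢0⇒m≢0 ∣ p ∣ {{ps≢0}}}}) ps≤n

nonsingular-⊗ : ∀ X Y → Nonsingular X → Nonsingular Y → Nonsingular (X ⊗ Y)
nonsingular-⊗ X Y X≢0 Y≢0 XY≡0 =
  Sum.[ X≢0 , Y≢0 ]′ (ℤ.i*j≡0⇒i≡0∨j≡0 (det X) (trans (sym (det-⊗ X Y)) XY≡0))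

nonsingular-⊗⁻ˡ : ∀ X Y → Nonsingular (X ⊗ Y) → Nonsingular X
nonsingular-⊗⁻ˡ X Y XY≢0 X≡0 = XY≢0 (trans (det-⊗ X Y) (cong (_* det Y) X≡0))

nonsingular-prod : ∀ {w} → All Nonsingular w → Nonsingular (prod w)
nonsingular-prod []                  = λ ()
nonsingular-prod {X ∷ w} (X≢0 ∷ w≢0) = nonsingular-⊗ X (prod w) X≢0 (nonsingular-prod w≢0)

-- Deciding membership of a nonsingular matrix.

module Membership (F : List Mat2) (F≢0 : All Nonsingular F) (M : Mat2) (M≢0 : Nonsingular M) where

  -- The box covers every possible H_i. Its other members are harmless, as `derivable-sound` holds
  -- for any list of states.
  anchors : List Mat2
  anchors = M ∷ I₂ ∷ box (∣det∣ M)

  routes : List (Mat2 × Mat2 × Mat2)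
  routes = cartesianProduct anchors (cartesianProduct (I₂ ∷ F) anchors)

  route : Mat2 × Mat2 × Mat2 → List Mat2
  route (A , N , B) = trail A (proj₁ (connect A (N ⊗ B)))

  states : List Mat2
  states = concatMap route routes

  open Automaton F states

  route⊆states : ∀ {A N B} → A ∈ anchors → N ∈ I₂ ∷ F → B ∈ anchors → ∀ {X} → X ∈ route (A , N , B) → X ∈ states
  route⊆states A∈ N∈ B∈ X∈ =
    ∈-concatMap⁺ route (lose (∈-cartesianProduct⁺ A∈ (∈-cartesianProduct⁺ N∈ B∈)) X∈)

  anchors⊆states : ∀ {A} → A ∈ anchors → A ∈ states
  anchors⊆states A∈ = route⊆states A∈ (here refl) A∈ (start∈trail _ _)

  trail-path : ∀ A w → All (_∈ letters) w → (∀ {X} → X ∈ trail A w → X ∈ states) → Path A w (A ⊗ prod w)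
  trail-path A []      []        ⊆states = subst (Path A []) (sym (⊗-identityʳ A)) []
  trail-path A (X ∷ w) (X∈ ∷ w∈) ⊆states =
    base (∈-transitions⁺ (⊆states (here refl)) X∈ (⊆states (there (start∈trail _ w)))) (here (sym (⊗-identityˡ _)))
    ∷ subst (Path (A ⊗ X) w) (⊗-assoc A X (prod w)) (trail-path (A ⊗ X) w w∈ (λ Y∈ → ⊆states (there Y∈)))

  -- `V` is read letter by letter with `I₂` as generator, leading from `A` to `N ⊗ B`; a last
  -- transition labelled `I₂` strips `N`.
  connect-path : ∀ {A N B V} → A ∈ anchors → N ∈ I₂ ∷ F → B ∈ anchors → Nonsingular A → ∣det∣ V ≡ 1 →
    A ⊗ V ≡ N ⊗ B → ∃[ w ] Path A w B × prod w ≡ V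
  connect-path {A} {N} {B} {V} A∈ N∈ B∈ A≢0 unit AV≡NB =
    let w , w∈ , correct = connect A (N ⊗ B)
        w≡V = correct A≢0 V unit AV≡NB
        Aw≡NB = trans (cong (A ⊗_) w≡V) AV≡NB
        ⊆states = route⊆states A∈ N∈ B∈
        δ = base (∈-transitions⁺ (⊆states (end∈trail A w)) (here refl) (anchors⊆states B∈))
              (lose N∈ (trans (⊗-identityʳ _) Aw≡NB))
    in w ++ I₂ ∷ [] , trail-path A w w∈ ⊆states ++ᴾ (δ ∷ []) ,
       trans (prod-++ w (I₂ ∷ [])) (trans (⊗-identityʳ (prod w)) w≡V)

  -- Induction from the right end: given `prod Ms` as H′ w′, write N H′ = H V and prepend a path for
  -- V. The bound passes to suffixes because |det N| ≥ 1.
  descend : ∀ {Ms} → All (_∈ F) Ms → ∣det∣ (prod Ms) ℕ.≤ ∣det∣ M →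
    ∃[ H ] ∃[ w ] H ∈ anchors × Path H w I₂ × H ⊗ prod w ≡ prod Ms
  descend [] _ = I₂ , [] , there (here refl) , [] , refl
  descend {N ∷ Ms} (N∈ ∷ Ms∈) bounded =
    let N≢0 = All.lookup F≢0 N∈
        H′ , w′ , H′∈ , p′ , H′w′≡ = descend Ms∈ (ℕ.≤-trans
          (ℕ.≤-trans (ℕ.m≤n*m (∣det∣ (prod Ms)) (∣det∣ N) {{ℕ.≢-nonZero (∣det∣≢0 {N} N≢0)}})
            (ℕ.≤-reflexive (sym (∣det∣-⊗ N (prod Ms))))) bounded)
        w′-unit = ∣det∣-∈⟨letters⟩ (w′ , path-letters p′ , refl)
        NH′w′≡ = trans (⊗-assoc N H′ (prod w′)) (cong (N ⊗_) H′w′≡)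
        NMs≢0 = nonsingular-⊗ N (prod Ms) N≢0 (nonsingular-prod (All.map (All.lookup F≢0) Ms∈))
        NH′≢0 = nonsingular-⊗⁻ˡ (N ⊗ H′) (prod w′) (subst Nonsingular (sym NH′w′≡) NMs≢0)
        H , V , V∈ , HV≡NH′ , bH≡0 , c<d = hermite (N ⊗ H′) NH′≢0
        H≢0 = nonsingular-⊗⁻ˡ H V (subst Nonsingular (sym HV≡NH′) NH′≢0)
        -- `V` and `prod w′` are unimodular, so |det H| equals |det (N H′ w′)|, which `bounded`
        -- controls.
        H∈ = there (there (lower∈box H H≢0 bH≡0 c<d (ℕ.≤-trans (ℕ.≤-reflexive (
               trans (∣det∣-⊗-unit H (∣det∣-∈⟨letters⟩ V∈)) (trans (cong ∣det∣ HV≡NH′)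
               (trans (∣det∣-⊗-unit (N ⊗ H′) w′-unit) (cong ∣det∣ NH′w′≡))))) bounded)))
        u , q , u≡V = connect-path H∈ (there N∈) H′∈ H≢0 (∣det∣-∈⟨letters⟩ V∈) HV≡NH′
    in H , u ++ w′ , H∈ , q ++ᴾ p′ ,
       trans (cong (H ⊗_) (trans (prod-++ u w′) (cong (_⊗ prod w′) u≡V)))
         (trans (sym (⊗-assoc H V (prod w′))) (trans (cong (_⊗ prod w′) HV≡NH′) NH′w′≡))
    where
    ∣det∣-⊗-unit : ∀ X {Y} → ∣det∣ Y ≡ 1 → ∣det∣ X ≡ ∣det∣ (X ⊗ Y)
    ∣det∣-⊗-unit X {Y} unit = sym (trans (∣det∣-⊗ X Y) (trans (cong (∣det∣ X ℕ.*_) unit) (ℕ.*-identityʳ (∣det∣ X))))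

  -- The path from H to `I₂` has a label w with M = H w. Walking first from M to H along the inverse
  -- of w makes the total label `I₂`.
  member⇒derivable : M ∈⟨ F ⟩ → Derivable (M , I₂ , I₂)
  member⇒derivable (Ms , Ms∈ , Ms≡M) =
    let H , w , H∈ , p , Hw≡Ms = descend Ms∈ (ℕ.≤-reflexive (cong ∣det∣ Ms≡M))
        Hw≡M = trans Hw≡Ms Ms≡M
        V , wV≡I , V-unit = rightInverse (prod w) (∣det∣-∈⟨letters⟩ (w , path-letters p , refl))
        MV≡H = begin
          M ⊗ V              ≡⟨ cong (_⊗ V) Hw≡M ⟨
          (H ⊗ prod w) ⊗ V   ≡⟨ ⊗-assoc H (prod w) V ⟩
          H ⊗ (prod w ⊗ V)   ≡⟨ cong (H ⊗_) wV≡I ⟩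
          H ⊗ I₂             ≡⟨ ⊗-identityʳ H ⟩
          H                  ∎
        u , q , u≡V = connect-path (here refl) (here refl) H∈ M≢0 V-unit (trans MV≡H (sym (⊗-identityˡ H)))
        M∈ = anchors⊆states (here refl)
        -- A loop labelled I₂: it makes the word of the path nonempty, as collapse requires.
        stay = base (∈-transitions⁺ M∈ (here refl) M∈) (here (trans (⊗-identityʳ M) (sym (⊗-identityˡ M))))
        -- `wV≡I` has its factors in the other order; cancelling M in M V w = H w = M yields V w =
        -- I.
        uw≡I = ⊗-cancelˡ {M} M≢0 (begin
          M ⊗ prod (u ++ w)      ≡⟨ cong (M ⊗_) (trans (prod-++ u w) (cong (_⊗ prod w) u≡V)) ⟩
          M ⊗ (V ⊗ prod w)       ≡⟨ ⊗-assoc M V (prod w) ⟨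
          (M ⊗ V) ⊗ prod w       ≡⟨ cong (_⊗ prod w) MV≡H ⟩
          H ⊗ prod w             ≡⟨ Hw≡M ⟩
          M                      ≡⟨ ⊗-identityʳ M ⟨
          M ⊗ I₂                 ∎)
    in collapse _ refl (stay ∷ (q ++ᴾ p)) (trans (⊗-identityˡ _) uw≡I)
    where open ≡-Reasoning

  derivable⇒member : Derivable (M , I₂ , I₂) → M ∈⟨ F ⟩
  derivable⇒member δ with N , N∈ , M≡N ← derivable-sound δ =
    subst (_∈⟨ F ⟩) (trans (sym (⊗-identityʳ N)) (trans (sym M≡N) (⊗-identityʳ M))) N∈

  member? : Dec (M ∈⟨ F ⟩)
  member? = map′ derivable⇒member member⇒derivable (derivable? _≟ᵀ_ _)

theorem1 : (F : List Mat2) → All Nonsingular F → (M : Mat2) → Dec (M ∈⟨ F ⟩)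
theorem1 F F≢0 M with det M ≟ 0ℤ
... | yes M≡0 = no λ { (Ms , Ms∈ , refl) → nonsingular-prod (All.map (All.lookup F≢0) Ms∈) M≡0 }
... | no  M≢0 = Membership.member? F F≢0 M M≢0
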